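{- Let $G=(A,B,E)$ be a bipartite graph. Then the following assertions are true: (i) $\ker_A(G)\cup\ker_B(G)=\ker(G)$; (ii) $|\ker(G)|+|\mathrm{diadem}(G)|=2\alpha(G)$; (iii) $|\ker_A(G)|+|\mathrm{diadem}_B(G)|=|\ker_B(G)|+|\mathrm{diadem}_A(G)|=\alpha(G)$; (iv) $\mathrm{diadem}_A(G)\cup\mathrm{diadem}_B(G)=\mathrm{diadem}(G)$.
   Context: All graphs are finite, undirected, without loops or multiple edges. $G=(A,B,E)$ denotes a bipartite graph with bipartition $\{A,B\}$, where $A\neq\emptyset\neq B$; its vertex set is $V=A\cup B$. For $X\subseteq V$, $N(X)=\{v\in V: v \text{ has a neighbor in } X\}$ and $d(X)=|X|-|N(X)|$, with $d(\emptyset)=0$. A set of vertices is independent if no two of its vertices are adjacent; $\alpha(G)$ is the maximum size of an independent set. Let $id_c(G)=\max\{d(I): I\subseteq V \text{ independent}\}$ (this is known to equal $d_c(G)=\max\{d(X):X\subseteq V\}$). A critical independent set is an independent set $S$ with $d(S)=id_c(G)$. $\ker(G)$ is the intersection, and $\mathrm{diadem}(G)$ the union, of all critical independent sets of $G$. Let $\delta_0(A)=\max\{d(X):X\subseteq A\}$ and $\delta_0(B)=\max\{d(Y):Y\subseteq B\}$ (the empty set is allowed). A set $X\subseteq A$ is $A$-critical if $d(X)=\delta_0(A)$; a set $Y\subseteq B$ is $B$-critical if $d(Y)=\delta_0(B)$. $\ker_A(G)$ is the intersection, and $\mathrm{diadem}_A(G)$ the union, of all $A$-critical sets; $\ker_B(G)$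 is the intersection, and $\mathrm{diadem}_B(G)$ the union, of all $B$-critical sets. -}

module Defs where

open import Data.Fin.Base using (Fin)
open import Data.Fin.Properties using (all?; any?)
open import Data.Fin.Subset
  using (Subset; inside; outside; ⊤; ⊥; _∈_; _⊆_; _∩_; _∪_; ⋂; ⋃; ∣_∣; Nonempty)
open import Data.Fin.Subset.Properties using (_∈?_; _⊆?_)
open import Data.Integer.Base as ℤ using (ℤ; +_; 0ℤ)
import Data.Integer.Properties as ℤ
open import Data.List.Base using (List; []; _∷_; _++_; map; filter)
import Data.List.Extrema as Extrema
open import Data.List.Membership.Propositional using () renaming (_∈_ to _∈ˡ_)
open import Data.List.Membership.Propositional.Properties using (∈-map⁺; ∈-++⁺ˡ; ∈-++⁺ʳ)
open import Data.List.Relation.Unary.Any using (here)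
open import Data.Nat.Base using (ℕ; zero; suc)
import Data.Nat.Properties as ℕ
open import Data.Product.Base using (_×_)
open import Data.Sum.Base using (_⊎_)
import Data.Vec.Base as Vec
open import Level using (0ℓ)
open import Relation.Binary.Core using (Rel)
open import Relation.Binary.Definitions using (Decidable; Symmetric)
open import Relation.Binary.PropositionalEquality using (_≡_; refl)
open import Relation.Nullary using (¬_; does; ¬?; _×-dec_; _→-dec_)
import Relation.Unary as U

-- Adjacency is decidable: a finite graph is given by its adjacency matrix.
record Graph (n : ℕ) : Set₁ where
  field
    _~_      : Rel (Fin n) 0ℓ
    _~?_     : Decidable _~_
    ~-sym    : Symmetric _~_
    ~-irrefl : ∀ v → ¬ (v ~ v)

record BipartiteGraph (n : ℕ) : Set₁ where
  field
    graph      : Graph n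
  open Graph graph public
  field
    A B        : Subset n
    A-nonempty : Nonempty A
    B-nonempty : Nonempty B
    disjoint   : A ∩ B ≡ ⊥
    cover      : A ∪ B ≡ ⊤
    crossing   : ∀ {u v} → u ~ v → (u ∈ A × v ∈ B) ⊎ (u ∈ B × v ∈ A)

subsets : ∀ n → List (Subset n)
subsets zero    = Vec.[] ∷ []
subsets (suc n) = map (outside Vec.∷_) (subsets n) ++ map (inside Vec.∷_) (subsets n)

∈-subsets : ∀ {n} (S : Subset n) → S ∈ˡ subsets n
∈-subsets Vec.[]              = here refl
∈-subsets (outside Vec.∷ S) = ∈-++⁺ˡ (∈-map⁺ (outside Vec.∷_) (∈-subsets S))
∈-subsets {suc n} (inside Vec.∷ S) =
  ∈-++⁺ʳ (map (outside Vec.∷_) (subsets n)) (∈-map⁺ (inside Vec.∷_) (∈-subsets S))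

module _ {n : ℕ} (G : Graph n) where
  open Graph G

  N : Subset n → Subset n
  N X = Vec.tabulate λ v → does (any? λ u → u ∈? X ×-dec (v ~? u))

  -- Integer-valued, since ∣ N X ∣ may exceed ∣ X ∣.
  d : Subset n → ℤ
  d X = + ∣ X ∣ ℤ.- + ∣ N X ∣

  Independent : Subset n → Set
  Independent S = ∀ u v → u ∈ S → v ∈ S → ¬ (u ~ v)

  independent? : U.Decidable Independent
  independent? S =
    all? λ u → all? λ v → u ∈? S →-dec (v ∈? S →-dec ¬? (u ~? v))

  -- In each maximum below, ∅ is one of the sets ranged over, with ∣ ∅ ∣ = 0
  -- and d ∅ = 0; the default value 0 of the list maximum is thus attained
  -- and does not alter the result.

  α : ℕ
  α = Extrema.max ℕ.≤-totalOrder 0 (map ∣_∣ (filter independent? (subsets n)))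

  idc : ℤ
  idc = Extrema.max ℤ.≤-totalOrder 0ℤ (map d (filter independent? (subsets n)))

  δ₀ : Subset n → ℤ
  δ₀ C = Extrema.max ℤ.≤-totalOrder 0ℤ (map d (filter (_⊆? C) (subsets n)))

  CriticalIndependent : Subset n → Set
  CriticalIndependent S = Independent S × d S ≡ idc

  criticalIndependent? : U.Decidable CriticalIndependent
  criticalIndependent? S = independent? S ×-dec (d S ℤ.≟ idc)

  ker : Subset n
  ker = ⋂ (filter criticalIndependent? (subsets n))

  diadem : Subset n
  diadem = ⋃ (filter criticalIndependent? (subsets n))

  -- CriticalIn C X is C-criticality of X; it is applied to the two colour
  -- classes C = A and C = B of a bipartite graph.
  CriticalIn : Subset n → Subset n → Set
  CriticalIn C X = X ⊆ C × d X ≡ δ₀ C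

  criticalIn? : ∀ C → U.Decidable (CriticalIn C)
  criticalIn? C X = (X ⊆? C) ×-dec (d X ℤ.≟ δ₀ C)

  kerIn : Subset n → Subset n
  kerIn C = ⋂ (filter (criticalIn? C) (subsets n))

  diademIn : Subset n → Subset n
  diademIn C = ⋃ (filter (criticalIn? C) (subsets n))

module _ {n : ℕ} (G : BipartiteGraph n) where
  open BipartiteGraph G

  kerA kerB diademA diademB : Subset n
  kerA    = kerIn graph A
  kerB    = kerIn graph B
  diademA = diademIn graph A
  diademB = diademIn graph B

{-# OPTIONS --safe #-}

-- To X ⊆ A associate its partner B ∖ N X.  Then X together with its partner is
-- independent of size d X + ∣ B ∣, and d (partner X) + ∣ A ∣ ≥ d X + ∣ B ∣.
-- Using both sides, δ₀ A + ∣ B ∣ = α = δ₀ B + ∣ A ∣ and the partner of an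
-- A-critical set X is a B-critical set Y with N Y = A ∖ X.  As d adds up over
-- the two sides, the critical independent sets are the independent unions of an
-- A-critical and a B-critical set, and every A-critical set occurs in one
-- through its partner; this yields (i) and (iv).  Since d is supermodular,
-- diademB is B-critical, and its partner is kerA; this yields (iii), and then (ii).

module Submission where

open import Defs
open import Data.Nat.Base using (ℕ; _+_; _*_)
open import Data.Fin.Subset using (_∪_; ∣_∣)
open import Data.Product.Base using (_×_)
open import Relation.Binary.PropositionalEquality using (_≡_)
open BipartiteGraph using (graph)

open import Data.Empty using (⊥-elim)
open import Data.Fin.Properties using (any?)
open import Data.Fin.Subset
  using (Subset; inside; outside; ⊥; _∈_; _∉_; _⊆_; _∩_; ∁; ⋂; ⋃; Empty)
open import Data.Fin.Subset.Properties
open import Data.Integer.Base as ℤ using (ℤ; +_; 0ℤ; +≤+)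
import Data.Integer.Properties as ℤ
open import Data.Integer.Tactic.RingSolver using (solve-∀)
open import Data.List.Base using (List; []; _∷_; map; filter)
import Data.List.Extrema as Extrema
open import Data.List.Membership.Propositional using () renaming (_∈_ to _∈ˡ_)
open import Data.List.Membership.Propositional.Properties
  using (∈-filter⁺; ∈-filter⁻; ∈-map⁺; ∈-map⁻)
open import Data.List.Relation.Unary.All as All using (All; []; _∷_)
open import Data.List.Relation.Unary.Any using (here; there)
open import Data.Nat.Base as ℕ using (suc)
import Data.Nat.Properties as ℕ
open import Data.Nat.Tactic.RingSolver using () renaming (solve-∀ to solve-∀-ℕ)
open import Data.Product.Base using (∃; _,_; proj₁; proj₂)
open import Data.Sum.Base as Sum using (_⊎_; inj₁; inj₂; [_,_]′)
import Data.Vec.Base as Vec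
open import Data.Vec.Properties using (lookup∘tabulate; []=⇒lookup; lookup⇒[]=)
open import Function.Base using (_∘_)
open import Level using (0ℓ)
open import Relation.Binary.Bundles using (TotalOrder)
open import Relation.Binary.PropositionalEquality
  using (refl; sym; trans; cong; cong₂; subst; subst₂; module ≡-Reasoning)
open import Relation.Nullary using (does; yes; no; _×-dec_)
open import Relation.Nullary.Decidable using (dec-true)
import Relation.Unary as U

-- Cardinalities of subsets

∣p∪q∣+∣p∩q∣≡∣p∣+∣q∣ : ∀ {n} (p q : Subset n) →
  ∣ p ∪ q ∣ + ∣ p ∩ q ∣ ≡ ∣ p ∣ + ∣ q ∣
∣p∪q∣+∣p∩q∣≡∣p∣+∣q∣ Vec.[] Vec.[] = refl
∣p∪q∣+∣p∩q∣≡∣p∣+∣q∣ (outside Vec.∷ p) (outside Vec.∷ q) = ∣p∪q∣+∣p∩q∣≡∣p∣+∣q∣ p q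
∣p∪q∣+∣p∩q∣≡∣p∣+∣q∣ (inside Vec.∷ p) (outside Vec.∷ q) =
  cong suc (∣p∪q∣+∣p∩q∣≡∣p∣+∣q∣ p q)
∣p∪q∣+∣p∩q∣≡∣p∣+∣q∣ (outside Vec.∷ p) (inside Vec.∷ q) =
  trans (cong suc (∣p∪q∣+∣p∩q∣≡∣p∣+∣q∣ p q)) (sym (ℕ.+-suc ∣ p ∣ ∣ q ∣))
∣p∪q∣+∣p∩q∣≡∣p∣+∣q∣ (inside Vec.∷ p) (inside Vec.∷ q) =
  cong suc (trans (ℕ.+-suc ∣ p ∪ q ∣ ∣ p ∩ q ∣)
    (trans (cong suc (∣p∪q∣+∣p∩q∣≡∣p∣+∣q∣ p q)) (sym (ℕ.+-suc ∣ p ∣ ∣ q ∣))))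

module _ {n : ℕ} where

  ∣p∪q∣≡∣p∣+∣q∣ : (p q : Subset n) → (∀ {x} → x ∈ p → x ∉ q) →
    ∣ p ∪ q ∣ ≡ ∣ p ∣ + ∣ q ∣
  ∣p∪q∣≡∣p∣+∣q∣ p q p∥q = begin
    ∣ p ∪ q ∣               ≡⟨ ℕ.+-identityʳ _ ⟨
    ∣ p ∪ q ∣ + 0           ≡⟨ cong (λ k → ∣ p ∪ q ∣ + k) (∣⊥∣≡0 n) ⟨
    ∣ p ∪ q ∣ + ∣ ⊥ {n} ∣   ≡⟨ cong (λ r → ∣ p ∪ q ∣ + ∣ r ∣) (Empty-unique empty) ⟨
    ∣ p ∪ q ∣ + ∣ p ∩ q ∣   ≡⟨ ∣p∪q∣+∣p∩q∣≡∣p∣+∣q∣ p q ⟩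
    ∣ p ∣ + ∣ q ∣           ∎
    where
    open ≡-Reasoning
    empty : Empty (p ∩ q)
    empty (x , x∈) = p∥q (proj₁ (x∈p∩q⁻ p q x∈)) (proj₂ (x∈p∩q⁻ p q x∈))

  p⊆q∧∣q∣≤∣p∣⇒q⊆p : {p q : Subset n} → p ⊆ q → ∣ q ∣ ℕ.≤ ∣ p ∣ → q ⊆ p
  p⊆q∧∣q∣≤∣p∣⇒q⊆p {p} p⊆q ∣q∣≤∣p∣ {x} x∈q with x ∈? p
  ... | yes x∈p = x∈p
  ... | no  x∉p =
    ⊥-elim (ℕ.<⇒≱ (p⊂q⇒∣p∣<∣q∣ (p⊆q , x , x∈q , x∉p)) ∣q∣≤∣p∣)

  ∣p∣+∣q∩∁p∣≡∣q∣ : (p q : Subset n) → p ⊆ q → ∣ p ∣ + ∣ q ∩ ∁ p ∣ ≡ ∣ q ∣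
  ∣p∣+∣q∩∁p∣≡∣q∣ p q p⊆q = trans
    (sym (∣p∪q∣≡∣p∣+∣q∣ p (q ∩ ∁ p)
      λ x∈p x∈ → x∈∁p⇒x∉p (proj₂ (x∈p∩q⁻ q (∁ p) x∈)) x∈p))
    (cong ∣_∣ (⊆-antisym to from))
    where
    to : p ∪ (q ∩ ∁ p) ⊆ q
    to x∈ = [ p⊆q , p∩q⊆p q (∁ p) ]′ (x∈p∪q⁻ p (q ∩ ∁ p) x∈)
    from : q ⊆ p ∪ (q ∩ ∁ p)
    from {x} x∈q with x ∈? p
    ... | yes x∈p = x∈p∪q⁺ (inj₁ x∈p)
    ... | no  x∉p = x∈p∪q⁺ (inj₂ (x∈p∩q⁺ (x∈q , x∉p⇒x∈∁p x∉p)))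

  ∪-least : {p q r : Subset n} → p ⊆ r → q ⊆ r → p ∪ q ⊆ r
  ∪-least {p} {q} p⊆r q⊆r = [ p⊆r , q⊆r ]′ ∘ x∈p∪q⁻ p q

-- Intersections, unions and maxima over a decidable family of subsets

  x∈⋂⁺ : ∀ {x} {ps : List (Subset n)} → All (x ∈_) ps → x ∈ ⋂ ps
  x∈⋂⁺ []         = ∈⊤
  x∈⋂⁺ (x∈p ∷ xs) = x∈p∩q⁺ (x∈p , x∈⋂⁺ xs)

  ⋂⊆ : ∀ {p} {ps : List (Subset n)} → p ∈ˡ ps → ⋂ ps ⊆ p
  ⋂⊆ {ps = q ∷ qs} (here refl)  = p∩q⊆p q (⋂ qs)
  ⋂⊆ {ps = q ∷ qs} (there p∈qs) = ⋂⊆ p∈qs ∘ p∩q⊆q q (⋂ qs)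

  ⊆⋃ : ∀ {p} {ps : List (Subset n)} → p ∈ˡ ps → p ⊆ ⋃ ps
  ⊆⋃ {ps = q ∷ qs} (here refl)  = p⊆p∪q (⋃ qs)
  ⊆⋃ {ps = q ∷ qs} (there p∈qs) = q⊆p∪q q (⋃ qs) ∘ ⊆⋃ p∈qs

  x∈⋃⁻ : ∀ {x} (ps : List (Subset n)) → x ∈ ⋃ ps → ∃ λ p → p ∈ˡ ps × x ∈ p
  x∈⋃⁻ []       x∈ = ⊥-elim (∉⊥ x∈)
  x∈⋃⁻ (p ∷ ps) x∈ with x∈p∪q⁻ p (⋃ ps) x∈
  ... | inj₁ x∈p = p , here refl , x∈p
  ... | inj₂ x∈⋃ = let q , q∈ps , x∈q = x∈⋃⁻ ps x∈⋃ in q , there q∈ps , x∈q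

  module _ {P : U.Pred (Subset n) 0ℓ} (P? : U.Decidable P) where

    family : List (Subset n)
    family = filter P? (subsets n)

    ∈-family : ∀ {S} → P S → S ∈ˡ family
    ∈-family {S} = ∈-filter⁺ P? (∈-subsets S)

    family-sound : ∀ {S} → S ∈ˡ family → P S
    family-sound = proj₂ ∘ ∈-filter⁻ P? {xs = subsets n}

    x∈⋂family : ∀ {x} → (∀ {S} → P S → x ∈ S) → x ∈ ⋂ family
    x∈⋂family x∈S = x∈⋂⁺ (All.tabulate (x∈S ∘ family-sound))

    x∈⋃family⁻ : ∀ {x} → x ∈ ⋃ family → ∃ λ S → P S × x ∈ S
    x∈⋃family⁻ x∈ =
      let S , S∈ , x∈S = x∈⋃⁻ family x∈ in S , family-sound S∈ , x∈S

    -- Folding from the empty union would require `P ⊥`, which may fail. So `S` is joined to every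
    -- partial union and is absorbed at the end, being itself a member of the family.
    ⋃family-closed : (∀ {S T} → P S → P T → P (S ∪ T)) → ∃ P → P (⋃ family)
    ⋃family-closed ∪-closed (S , PS) =
      subst P (⊆-antisym (∪-least (⊆⋃ (∈-family PS)) (λ x → x)) (q⊆p∪q S (⋃ family)))
        (go family (All.tabulate family-sound))
      where
      go : ∀ ps → All P ps → P (S ∪ ⋃ ps)
      go [] [] = subst P (sym (∪-identityʳ S)) PS
      go (p ∷ ps) (Pp ∷ Pps) = subst P swap-front (∪-closed Pp (go ps Pps))
        where
        swap-front : p ∪ (S ∪ ⋃ ps) ≡ S ∪ (p ∪ ⋃ ps)
        swap-front = trans (sym (∪-assoc p S (⋃ ps)))
          (trans (cong (_∪ ⋃ ps) (∪-comm p S)) (∪-assoc S p (⋃ ps)))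

    module _ (O : TotalOrder 0ℓ 0ℓ 0ℓ) where
      open TotalOrder O using (Carrier; _≤_)
      open Extrema O

      ≤max-family : ∀ (f : Subset n → Carrier) e {S} → P S →
        f S ≤ max e (map f family)
      ≤max-family f e PS = All.lookup (xs≤max e (map f family)) (∈-map⁺ f (∈-family PS))

      -- The list maximum may be its default `e` instead of a listed value; a member `S` with
      -- `f S ≡ e` serves as the witness in that case.
      max-family-attained : ∀ (f : Subset n → Carrier) {e S} → P S → f S ≡ e →
        ∃ λ T → P T × f T ≡ max e (map f family)
      max-family-attained f {e} {S} PS fS≡e with argmax-sel (λ x → x) e (map f family)
      ... | inj₁ max≡e = S , PS , trans fS≡e (sym max≡e)
      ... | inj₂ max∈  =
        let T , T∈ , max≡fT = ∈-map⁻ f max∈ in T , family-sound T∈ , sym max≡fT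

-- Integer inequalities

-- Transfers an inequality to another with the same difference of sides, so that what remains is an
-- identity for the ring solver.
≤-by-difference : ∀ {i j k l : ℤ} → i ℤ.≤ j → j ℤ.- i ≡ l ℤ.- k → k ℤ.≤ l
≤-by-difference i≤j eq = ℤ.0≤i-j⇒j≤i (subst (0ℤ ℤ.≤_) eq (ℤ.i≤j⇒0≤j-i i≤j))

i+k≤j+k⇒i≤j : ∀ k {i j : ℤ} → i ℤ.+ k ℤ.≤ j ℤ.+ k → i ℤ.≤ j
i+k≤j+k⇒i≤j k {i} {j} i+k≤j+k = ≤-by-difference i+k≤j+k (cancel i j k)
  where
  cancel : ∀ i j k → (j ℤ.+ k) ℤ.- (i ℤ.+ k) ≡ j ℤ.- i
  cancel = solve-∀

-- Neighbourhoods, the difference `d` and the attained maxima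

module _ {n : ℕ} (G : Graph n) where
  open Graph G

  private
    dec : ∀ X v → _
    dec X v = any? λ u → u ∈? X ×-dec (v ~? u)

  ∈N⁺ : ∀ {X u v} → u ∈ X → v ~ u → v ∈ N G X
  ∈N⁺ {X} {u} {v} u∈X v~u = lookup⇒[]= v (N G X)
    (trans (lookup∘tabulate (does ∘ dec X) v) (dec-true (dec X v) (u , u∈X , v~u)))

  ∈N⁻ : ∀ {X v} → v ∈ N G X → ∃ λ u → u ∈ X × v ~ u
  -- Abstracting the decision together with the equation `does (dec X v) ≡ inside` turns the
  -- negative case into an absurd equation.
  ∈N⁻ {X} {v} v∈ with dec X v
    | trans (sym (lookup∘tabulate (does ∘ dec X) v)) ([]=⇒lookup v∈)
  ... | yes w | _  = w
  ... | no  _ | ()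

  N-mono : ∀ {X Y} → X ⊆ Y → N G X ⊆ N G Y
  N-mono X⊆Y v∈ = let u , u∈X , v~u = ∈N⁻ v∈ in ∈N⁺ (X⊆Y u∈X) v~u

  N-∪ : ∀ X Y → N G (X ∪ Y) ≡ N G X ∪ N G Y
  N-∪ X Y = ⊆-antisym to (∪-least (N-mono (p⊆p∪q Y)) (N-mono (q⊆p∪q X Y)))
    where
    to : N G (X ∪ Y) ⊆ N G X ∪ N G Y
    to v∈ with ∈N⁻ v∈
    ... | u , u∈ , v~u = x∈p∪q⁺ (Sum.map (λ m → ∈N⁺ m v~u) (λ m → ∈N⁺ m v~u) (x∈p∪q⁻ X Y u∈))

  -- Only an inclusion: a vertex may have neighbours in `X` and in `Y` but none in `X ∩ Y`. This is
  -- where `d` fails to be modular.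
  N-∩ : ∀ X Y → N G (X ∩ Y) ⊆ N G X ∩ N G Y
  N-∩ X Y v∈ = x∈p∩q⁺ (N-mono (p∩q⊆p X Y) v∈ , N-mono (p∩q⊆q X Y) v∈)

  N-⊥ : N G ⊥ ≡ ⊥
  N-⊥ = Empty-unique λ (v , v∈) → ∉⊥ (proj₁ (proj₂ (∈N⁻ v∈)))

  d-⊥ : d G ⊥ ≡ 0ℤ
  d-⊥ = begin
    + ∣ ⊥ {n} ∣ ℤ.- + ∣ N G ⊥ ∣   ≡⟨ cong (λ Z → + ∣ ⊥ {n} ∣ ℤ.- + ∣ Z ∣) N-⊥ ⟩
    + ∣ ⊥ {n} ∣ ℤ.- + ∣ ⊥ {n} ∣   ≡⟨ ℤ.+-inverseʳ (+ ∣ ⊥ {n} ∣) ⟩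
    0ℤ                            ∎
    where open ≡-Reasoning

  ⊥-independent : Independent G ⊥
  ⊥-independent _ _ u∈⊥ = ⊥-elim (∉⊥ u∈⊥)

  -- Cardinality is modular, while `N` preserves unions and shrinks intersections, so the size of
  -- the neighbourhood is submodular; it enters `d` with a minus sign.
  d-supermodular : ∀ X Y → d G X ℤ.+ d G Y ℤ.≤ d G (X ∪ Y) ℤ.+ d G (X ∩ Y)
  d-supermodular X Y = subst₂ ℤ._≤_
    (shuffle (+ ∣ X ∣) (+ ∣ N G X ∣) (+ ∣ Y ∣) (+ ∣ N G Y ∣))
    (shuffle (+ ∣ X ∪ Y ∣) (+ ∣ N G (X ∪ Y) ∣) (+ ∣ X ∩ Y ∣) (+ ∣ N G (X ∩ Y) ∣))
    (ℤ.+-mono-≤ (ℤ.≤-reflexive (cong +_ (sym (∣p∪q∣+∣p∩q∣≡∣p∣+∣q∣ X Y))))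
      (ℤ.neg-mono-≤ (+≤+ N-bound)))
    where
    shuffle : ∀ i j k l → (i ℤ.+ k) ℤ.- (j ℤ.+ l) ≡ (i ℤ.- j) ℤ.+ (k ℤ.- l)
    shuffle = solve-∀
    N-bound : ∣ N G (X ∪ Y) ∣ + ∣ N G (X ∩ Y) ∣ ℕ.≤ ∣ N G X ∣ + ∣ N G Y ∣
    N-bound = begin
      ∣ N G (X ∪ Y) ∣ + ∣ N G (X ∩ Y) ∣
        ≤⟨ ℕ.+-mono-≤ (ℕ.≤-reflexive (cong ∣_∣ (N-∪ X Y))) (p⊆q⇒∣p∣≤∣q∣ (N-∩ X Y)) ⟩
      ∣ N G X ∪ N G Y ∣ + ∣ N G X ∩ N G Y ∣
        ≡⟨ ∣p∪q∣+∣p∩q∣≡∣p∣+∣q∣ (N G X) (N G Y) ⟩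
      ∣ N G X ∣ + ∣ N G Y ∣  ∎
      where open ℕ.≤-Reasoning

  ∣S∣≤α : ∀ {S} → Independent G S → ∣ S ∣ ℕ.≤ α G
  ∣S∣≤α = ≤max-family (independent? G) ℕ.≤-totalOrder ∣_∣ 0

  α-attained : ∃ λ S → Independent G S × ∣ S ∣ ≡ α G
  α-attained = max-family-attained (independent? G) ℕ.≤-totalOrder ∣_∣ ⊥-independent (∣⊥∣≡0 n)

  d≤idc : ∀ {S} → Independent G S → d G S ℤ.≤ idc G
  d≤idc = ≤max-family (independent? G) ℤ.≤-totalOrder (d G) 0ℤ

  idc-attained : ∃ λ S → Independent G S × d G S ≡ idc G
  idc-attained = max-family-attained (independent? G) ℤ.≤-totalOrder (d G) ⊥-independent d-⊥

  d≤δ₀ : ∀ C {X} → X ⊆ C → d G X ℤ.≤ δ₀ G C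
  d≤δ₀ C = ≤max-family (_⊆? C) ℤ.≤-totalOrder (d G) 0ℤ

  criticalIn-exists : ∀ C → ∃ (CriticalIn G C)
  criticalIn-exists C =
    max-family-attained (_⊆? C) ℤ.≤-totalOrder (d G) (⊆-min C) d-⊥

  -- The two values on the left of supermodularity are maximal and `d G (X ∩ Y)` is at most
  -- `δ₀ G C`, which leaves at least `δ₀ G C` for the union.
  criticalIn-∪ : ∀ C {X Y} → CriticalIn G C X → CriticalIn G C Y → CriticalIn G C (X ∪ Y)
  criticalIn-∪ C {X} {Y} (X⊆C , dX) (Y⊆C , dY) =
    X∪Y⊆C , ℤ.≤-antisym (d≤δ₀ C X∪Y⊆C) (i+k≤j+k⇒i≤j (δ₀ G C) bound)
    where
    X∪Y⊆C = ∪-least X⊆C Y⊆C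
    bound : δ₀ G C ℤ.+ δ₀ G C ℤ.≤ d G (X ∪ Y) ℤ.+ δ₀ G C
    bound = begin
      δ₀ G C ℤ.+ δ₀ G C              ≡⟨ cong₂ ℤ._+_ dX dY ⟨
      d G X ℤ.+ d G Y                ≤⟨ d-supermodular X Y ⟩
      d G (X ∪ Y) ℤ.+ d G (X ∩ Y)
        ≤⟨ ℤ.+-monoʳ-≤ (d G (X ∪ Y)) (d≤δ₀ C (X⊆C ∘ p∩q⊆p X Y)) ⟩
      d G (X ∪ Y) ℤ.+ δ₀ G C         ∎
      where open ℤ.≤-Reasoning

  diademIn-critical : ∀ C → CriticalIn G C (diademIn G C)
  diademIn-critical C =
    ⋃family-closed (criticalIn? G C) (criticalIn-∪ C) (criticalIn-exists C)

-- Partners in a bipartite graph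

-- Lemmas are proved for the side `A` only; applied to `swap G` they give the version for `B`. The
-- graph is unchanged, and `kerA (swap G)` and `diademA (swap G)` are `kerB G` and `diademB G` by
-- definition.
swap : ∀ {n} → BipartiteGraph n → BipartiteGraph n
swap G = record
  { graph      = H
  ; A          = B
  ; B          = A
  ; A-nonempty = B-nonempty
  ; B-nonempty = A-nonempty
  ; disjoint   = trans (∩-comm B A) disjoint
  ; cover      = trans (∪-comm B A) cover
  ; crossing   = Sum.swap ∘ crossing
  }
  where open BipartiteGraph G renaming (graph to H)

module _ {n : ℕ} (G : BipartiteGraph n) where
  open BipartiteGraph G renaming (graph to H)

  A∌B : ∀ {v} → v ∈ A → v ∉ B
  A∌B v∈A v∈B = ∉⊥ (subst (_ ∈_) disjoint (x∈p∩q⁺ (v∈A , v∈B)))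

  A-or-B : ∀ v → v ∈ A ⊎ v ∈ B
  A-or-B v = x∈p∪q⁻ A B (subst (v ∈_) (sym cover) ∈⊤)

  N⊆B : ∀ {X} → X ⊆ A → N H X ⊆ B
  N⊆B X⊆A v∈ with ∈N⁻ H v∈
  ... | u , u∈X , v~u with crossing v~u
  ...   | inj₁ (_ , u∈B) = ⊥-elim (A∌B (X⊆A u∈X) u∈B)
  ...   | inj₂ (v∈B , _) = v∈B

  S≡S∩A∪S∩B : ∀ S → S ≡ (S ∩ A) ∪ (S ∩ B)
  S≡S∩A∪S∩B S = trans (sym (∩-identityʳ S))
    (trans (cong (S ∩_) (sym cover)) (∩-distribˡ-∪ S A B))

  -- The largest subset of `B` with no edge to `X`, hence the largest independent extension of a set
  -- `X ⊆ A` into `B`.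
  partner : Subset n → Subset n
  partner X = B ∩ ∁ (N H X)

  partner⊆B : ∀ X → partner X ⊆ B
  partner⊆B X = p∩q⊆p B (∁ (N H X))

  partner∌N : ∀ X {v} → v ∈ partner X → v ∉ N H X
  partner∌N X = x∈∁p⇒x∉p ∘ p∩q⊆q B (∁ (N H X))

  N-partner⊆∁ : ∀ X {v} → v ∈ N H (partner X) → v ∉ X
  N-partner⊆∁ X v∈ v∈X with ∈N⁻ H v∈
  ... | u , u∈ , v~u = partner∌N X u∈ (∈N⁺ H v∈X (~-sym v~u))

  module _ {X : Subset n} (X⊆A : X ⊆ A) where

    X∌partner : ∀ {v} → v ∈ X → v ∉ partner X
    X∌partner v∈X = A∌B (X⊆A v∈X) ∘ partner⊆B X

    -- Since `N H X` lies in `B`, the partner has `∣ B ∣` minus `∣ N H X ∣` elements.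
    ∣X∣+∣partner∣ : + (∣ X ∣ + ∣ partner X ∣) ≡ d H X ℤ.+ + ∣ B ∣
    ∣X∣+∣partner∣ = trans
      (cancel (+ ∣ X ∣) (+ ∣ N H X ∣) (+ ∣ partner X ∣))
      (cong (λ m → d H X ℤ.+ + m) (∣p∣+∣q∩∁p∣≡∣q∣ (N H X) B (N⊆B X⊆A)))
      where
      cancel : ∀ i j k → i ℤ.+ k ≡ (i ℤ.- j) ℤ.+ (j ℤ.+ k)
      cancel = solve-∀

    ∪partner-independent : Independent H (X ∪ partner X)
    ∪partner-independent u v u∈ v∈ u~v
      with x∈p∪q⁻ X (partner X) u∈ | x∈p∪q⁻ X (partner X) v∈
    ... | inj₁ u∈X | inj₁ v∈X = A∌B (X⊆A u∈X) (N⊆B X⊆A (∈N⁺ H v∈X u~v))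
    ... | inj₁ u∈X | inj₂ v∈Y = partner∌N X v∈Y (∈N⁺ H u∈X (~-sym u~v))
    ... | inj₂ u∈Y | inj₁ v∈X = partner∌N X u∈Y (∈N⁺ H v∈X u~v)
    ... | inj₂ u∈Y | inj₂ v∈Y with crossing u~v
    ...   | inj₁ (u∈A , _) = A∌B u∈A (partner⊆B X u∈Y)
    ...   | inj₂ (_ , v∈A) = A∌B v∈A (partner⊆B X v∈Y)

    -- Not only are `X` and `Y` disjoint: `N H X` lies in `B` and `N H Y` in `A`, so the
    -- neighbourhoods are disjoint too and both cardinalities add up.
    d-∪ : ∀ {Y} → Y ⊆ B → d H (X ∪ Y) ≡ d H X ℤ.+ d H Y
    d-∪ {Y} Y⊆B = trans
      (cong₂ (λ k l → + k ℤ.- + l)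
        (∣p∪q∣≡∣p∣+∣q∣ X Y λ v∈X → A∌B (X⊆A v∈X) ∘ Y⊆B)
        (trans (cong ∣_∣ (N-∪ H X Y)) (∣p∪q∣≡∣p∣+∣q∣ (N H X) (N H Y) NX∌NY)))
      (shuffle (+ ∣ X ∣) (+ ∣ Y ∣) (+ ∣ N H X ∣) (+ ∣ N H Y ∣))
      where
      shuffle : ∀ i j k l → (i ℤ.+ j) ℤ.- (k ℤ.+ l) ≡ (i ℤ.- k) ℤ.+ (j ℤ.- l)
      shuffle = solve-∀
      NX∌NY : ∀ {v} → v ∈ N H X → v ∉ N H Y
      NX∌NY v∈NX v∈NY with ∈N⁻ H v∈NY
      ... | u , u∈Y , v~u with crossing v~u
      ...   | inj₁ (v∈A , _) = A∌B v∈A (N⊆B X⊆A v∈NX)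
      ...   | inj₂ (_ , u∈A) = A∌B u∈A (Y⊆B u∈Y)

  d-split : ∀ S → d H S ≡ d H (S ∩ A) ℤ.+ d H (S ∩ B)
  d-split S = trans (cong (d H) (S≡S∩A∪S∩B S)) (d-∪ (p∩q⊆q S A) (p∩q⊆q S B))

-- Comparison of the two sides and the independence number

module _ {n : ℕ} (G : BipartiteGraph n) where
  open BipartiteGraph G renaming (graph to H)

  N-partner⊆A : ∀ X → N H (partner G X) ⊆ A
  N-partner⊆A X = N⊆B (swap G) (partner⊆B G X)

  -- The neighbourhood of the partner and `X` are disjoint subsets of `A`.
  ∣N-partner∣+∣X∣≤∣A∣ : ∀ {X} → X ⊆ A → ∣ N H (partner G X) ∣ + ∣ X ∣ ℕ.≤ ∣ A ∣
  ∣N-partner∣+∣X∣≤∣A∣ {X} X⊆A = subst (ℕ._≤ ∣ A ∣)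
    (∣p∪q∣≡∣p∣+∣q∣ (N H (partner G X)) X (N-partner⊆∁ G X))
    (p⊆q⇒∣p∣≤∣q∣ (∪-least (N-partner⊆A X) X⊆A))

  d-partner : ∀ {X} → X ⊆ A → d H X ℤ.+ + ∣ B ∣ ℤ.≤ d H (partner G X) ℤ.+ + ∣ A ∣
  d-partner {X} X⊆A = subst (ℤ._≤ d H (partner G X) ℤ.+ + ∣ A ∣)
    (∣X∣+∣partner∣ G X⊆A)
    -- Both inequalities have the same slack, namely the number of vertices of `A` outside `X` and
    -- outside the neighbourhood of its partner.
    (≤-by-difference (+≤+ (∣N-partner∣+∣X∣≤∣A∣ X⊆A))
      (rearrange (+ ∣ A ∣) (+ ∣ N H (partner G X) ∣) (+ ∣ X ∣) (+ ∣ partner G X ∣)))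
    where
    rearrange : ∀ a m x y → a ℤ.- (m ℤ.+ x) ≡ ((y ℤ.- m) ℤ.+ a) ℤ.- (x ℤ.+ y)
    rearrange = solve-∀

  δ₀-shift-≤ : δ₀ H A ℤ.+ + ∣ B ∣ ℤ.≤ δ₀ H B ℤ.+ + ∣ A ∣
  δ₀-shift-≤ with criticalIn-exists H A
  ... | X , X⊆A , dX = begin
    δ₀ H A ℤ.+ + ∣ B ∣            ≡⟨ cong (ℤ._+ + ∣ B ∣) dX ⟨
    d H X ℤ.+ + ∣ B ∣             ≤⟨ d-partner X⊆A ⟩
    d H (partner G X) ℤ.+ + ∣ A ∣ ≤⟨ ℤ.+-monoˡ-≤ (+ ∣ A ∣) (d≤δ₀ H B (partner⊆B G X)) ⟩
    δ₀ H B ℤ.+ + ∣ A ∣            ∎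
    where open ℤ.≤-Reasoning

  α≡δ₀+∣B∣ : + α H ≡ δ₀ H A ℤ.+ + ∣ B ∣
  α≡δ₀+∣B∣ = ℤ.≤-antisym upper lower
    where
    open ℤ.≤-Reasoning
    lower : δ₀ H A ℤ.+ + ∣ B ∣ ℤ.≤ + α H
    lower with criticalIn-exists H A
    ... | X , X⊆A , dX = begin
      δ₀ H A ℤ.+ + ∣ B ∣            ≡⟨ cong (ℤ._+ + ∣ B ∣) dX ⟨
      d H X ℤ.+ + ∣ B ∣             ≡⟨ ∣X∣+∣partner∣ G X⊆A ⟨
      + (∣ X ∣ + ∣ partner G X ∣)
        ≡⟨ cong +_ (∣p∪q∣≡∣p∣+∣q∣ X (partner G X) (X∌partner G X⊆A)) ⟨
      + ∣ X ∪ partner G X ∣         ≤⟨ +≤+ (∣S∣≤α H (∪partner-independent G X⊆A)) ⟩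
      + α H                         ∎
    -- Independence puts `S ∩ B` inside the partner of `S ∩ A`, so a maximum independent `S` is no
    -- larger than `S ∩ A` together with that partner.
    upper : + α H ℤ.≤ δ₀ H A ℤ.+ + ∣ B ∣
    upper with α-attained H
    ... | S , S-ind , ∣S∣≡α = begin
      + α H                                  ≡⟨ cong +_ ∣S∣≡α ⟨
      + ∣ S ∣                                ≡⟨ cong (λ Z → + ∣ Z ∣) (S≡S∩A∪S∩B G S) ⟩
      + ∣ (S ∩ A) ∪ (S ∩ B) ∣                ≤⟨ +≤+ (p⊆q⇒∣p∣≤∣q∣ into) ⟩
      + ∣ (S ∩ A) ∪ partner G (S ∩ A) ∣
        ≡⟨ cong +_ (∣p∪q∣≡∣p∣+∣q∣ (S ∩ A) _ (X∌partner G (p∩q⊆q S A))) ⟩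
      + (∣ S ∩ A ∣ + ∣ partner G (S ∩ A) ∣)  ≡⟨ ∣X∣+∣partner∣ G (p∩q⊆q S A) ⟩
      d H (S ∩ A) ℤ.+ + ∣ B ∣                ≤⟨ ℤ.+-monoˡ-≤ (+ ∣ B ∣) (d≤δ₀ H A (p∩q⊆q S A)) ⟩
      δ₀ H A ℤ.+ + ∣ B ∣                     ∎
      where
      S∩B⊆partner : S ∩ B ⊆ partner G (S ∩ A)
      S∩B⊆partner {v} v∈ = x∈p∩q⁺ (p∩q⊆q S B v∈ , x∉p⇒x∈∁p λ v∈N →
        let u , u∈ , v~u = ∈N⁻ H v∈N in
        S-ind v u (p∩q⊆p S B v∈) (p∩q⊆p S A u∈) v~u)
      into : (S ∩ A) ∪ (S ∩ B) ⊆ (S ∩ A) ∪ partner G (S ∩ A)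
      into = ∪-least (p⊆p∪q _) (q⊆p∪q (S ∩ A) _ ∘ S∩B⊆partner)

-- Critical sets, their partners and critical independent sets

module _ {n : ℕ} (G : BipartiteGraph n) where
  open BipartiteGraph G renaming (graph to H)

  δ₀-shift : δ₀ H A ℤ.+ + ∣ B ∣ ≡ δ₀ H B ℤ.+ + ∣ A ∣
  δ₀-shift = ℤ.≤-antisym (δ₀-shift-≤ G) (δ₀-shift-≤ (swap G))

  partner-critical : ∀ {X} → CriticalIn H A X → CriticalIn H B (partner G X)
  partner-critical {X} (X⊆A , dX) = partner⊆B G X ,
    ℤ.≤-antisym (d≤δ₀ H B (partner⊆B G X)) (i+k≤j+k⇒i≤j (+ ∣ A ∣) bound)
    where
    open ℤ.≤-Reasoning
    bound : δ₀ H B ℤ.+ + ∣ A ∣ ℤ.≤ d H (partner G X) ℤ.+ + ∣ A ∣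
    bound = begin
      δ₀ H B ℤ.+ + ∣ A ∣             ≡⟨ δ₀-shift ⟨
      δ₀ H A ℤ.+ + ∣ B ∣             ≡⟨ cong (ℤ._+ + ∣ B ∣) dX ⟨
      d H X ℤ.+ + ∣ B ∣              ≤⟨ d-partner G X⊆A ⟩
      d H (partner G X) ℤ.+ + ∣ A ∣  ∎

  -- From above, `d` splits over the two sides. From below, an `A`-critical set and its partner
  -- attain both maxima at once and have an independent union.
  idc≡δ₀A+δ₀B : idc H ≡ δ₀ H A ℤ.+ δ₀ H B
  idc≡δ₀A+δ₀B = ℤ.≤-antisym upper lower
    where
    open ℤ.≤-Reasoning
    upper : idc H ℤ.≤ δ₀ H A ℤ.+ δ₀ H B
    upper with idc-attained H
    ... | S , _ , dS = begin
      idc H                         ≡⟨ dS ⟨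
      d H S                         ≡⟨ d-split G S ⟩
      d H (S ∩ A) ℤ.+ d H (S ∩ B)
        ≤⟨ ℤ.+-mono-≤ (d≤δ₀ H A (p∩q⊆q S A)) (d≤δ₀ H B (p∩q⊆q S B)) ⟩
      δ₀ H A ℤ.+ δ₀ H B             ∎
    lower : δ₀ H A ℤ.+ δ₀ H B ℤ.≤ idc H
    lower with criticalIn-exists H A
    ... | X , X-crit@(X⊆A , dX) = begin
      δ₀ H A ℤ.+ δ₀ H B            ≡⟨ cong₂ ℤ._+_ dX (proj₂ (partner-critical X-crit)) ⟨
      d H X ℤ.+ d H (partner G X)  ≡⟨ d-∪ G X⊆A (partner⊆B G X) ⟨
      d H (X ∪ partner G X)        ≤⟨ d≤idc H (∪partner-independent G X⊆A) ⟩
      idc H                        ∎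

  ∪partner-critical : ∀ {X} → CriticalIn H A X → CriticalIndependent H (X ∪ partner G X)
  ∪partner-critical {X} X-crit@(X⊆A , dX) = ∪partner-independent G X⊆A ,
    (begin
      d H (X ∪ partner G X)        ≡⟨ d-∪ G X⊆A (partner⊆B G X) ⟩
      d H X ℤ.+ d H (partner G X)  ≡⟨ cong₂ ℤ._+_ dX (proj₂ (partner-critical X-crit)) ⟩
      δ₀ H A ℤ.+ δ₀ H B            ≡⟨ idc≡δ₀A+δ₀B ⟨
      idc H                        ∎)
    where open ≡-Reasoning

  -- The two parts of `S` are bounded by `δ₀ H A` and `δ₀ H B` and reach the sum of these bounds, so
  -- the part in `A` reaches its own.
  critical∩A : ∀ {S} → CriticalIndependent H S → CriticalIn H A (S ∩ A)
  critical∩A {S} (_ , dS) = p∩q⊆q S A ,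
    ℤ.≤-antisym (d≤δ₀ H A (p∩q⊆q S A)) (i+k≤j+k⇒i≤j (δ₀ H B) bound)
    where
    open ℤ.≤-Reasoning
    bound : δ₀ H A ℤ.+ δ₀ H B ℤ.≤ d H (S ∩ A) ℤ.+ δ₀ H B
    bound = begin
      δ₀ H A ℤ.+ δ₀ H B            ≡⟨ idc≡δ₀A+δ₀B ⟨
      idc H                        ≡⟨ dS ⟨
      d H S                        ≡⟨ d-split G S ⟩
      d H (S ∩ A) ℤ.+ d H (S ∩ B)  ≤⟨ ℤ.+-monoʳ-≤ (d H (S ∩ A)) (d≤δ₀ H B (p∩q⊆q S B)) ⟩
      d H (S ∩ A) ℤ.+ δ₀ H B       ∎

  -- For a critical `X` the bound `∣N-partner∣+∣X∣≤∣A∣` is an equality, so `X` and the neighbourhood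
  -- of its partner fill all of `A`.
  ∁N-partner⊆X : ∀ {X v} → CriticalIn H A X → v ∈ A → v ∉ N H (partner G X) → v ∈ X
  ∁N-partner⊆X {X} X-crit@(X⊆A , dX) v∈A v∉N =
    [ ⊥-elim ∘ v∉N , (λ v∈X → v∈X) ]′ (x∈p∪q⁻ (N H Y) X
      (p⊆q∧∣q∣≤∣p∣⇒q⊆p (∪-least (N-partner⊆A G X) X⊆A) ∣A∣≤ v∈A))
    where
    Y = partner G X
    -- This is `d-partner` with equality, as `X` and its partner are both critical.
    counts : + (∣ X ∣ + ∣ Y ∣) ≡ d H Y ℤ.+ + ∣ A ∣
    counts = begin
      + (∣ X ∣ + ∣ Y ∣)    ≡⟨ ∣X∣+∣partner∣ G X⊆A ⟩
      d H X ℤ.+ + ∣ B ∣    ≡⟨ cong (ℤ._+ + ∣ B ∣) dX ⟩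
      δ₀ H A ℤ.+ + ∣ B ∣   ≡⟨ δ₀-shift ⟩
      δ₀ H B ℤ.+ + ∣ A ∣   ≡⟨ cong (ℤ._+ + ∣ A ∣) (proj₂ (partner-critical X-crit)) ⟨
      d H Y ℤ.+ + ∣ A ∣    ∎
      where open ≡-Reasoning
    rearrange : ∀ a m x y → (x ℤ.+ y) ℤ.- ((y ℤ.- m) ℤ.+ a) ≡ (m ℤ.+ x) ℤ.- a
    rearrange = solve-∀
    ∣A∣≤ : ∣ A ∣ ℕ.≤ ∣ N H Y ∪ X ∣
    ∣A∣≤ = subst (∣ A ∣ ℕ.≤_) (sym (∣p∪q∣≡∣p∣+∣q∣ (N H Y) X (N-partner⊆∁ G X)))
      (ℤ.drop‿+≤+ (≤-by-difference (ℤ.≤-reflexive (sym counts))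
        (rearrange (+ ∣ A ∣) (+ ∣ N H Y ∣) (+ ∣ X ∣) (+ ∣ Y ∣))))

-- Kernels and diadems

module _ {n : ℕ} (G : BipartiteGraph n) where
  open BipartiteGraph G renaming (graph to H)

  kerA⊆ : ∀ {X} → CriticalIn H A X → kerA G ⊆ X
  kerA⊆ X-crit = ⋂⊆ (∈-family (criticalIn? H A) X-crit)

  kerA⊆A : kerA G ⊆ A
  kerA⊆A = let X , X⊆A , dX = criticalIn-exists H A in X⊆A ∘ kerA⊆ (X⊆A , dX)

  diademA⊆A : diademA G ⊆ A
  diademA⊆A = proj₁ (diademIn-critical H A)

  -- Each critical independent set meets `A` in an `A`-critical set, which contains `kerA G`.
  kerA⊆ker : kerA G ⊆ ker H
  kerA⊆ker v∈ = x∈⋂family (criticalIndependent? H) λ {S} S-crit →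
    p∩q⊆p S A (kerA⊆ (critical∩A G S-crit) v∈)

  -- Each `A`-critical `X` becomes critical independent when its partner is added; the partner lies
  -- in `B`, so a vertex of `A` in the union comes from `X`.
  ker∩A⊆kerA : ∀ {v} → v ∈ ker H → v ∈ A → v ∈ kerA G
  ker∩A⊆kerA v∈ v∈A = x∈⋂family (criticalIn? H A) λ {X} X-crit →
    [ (λ v∈X → v∈X) , ⊥-elim ∘ A∌B G v∈A ∘ partner⊆B G X ]′
      (x∈p∪q⁻ X (partner G X)
        (⋂⊆ (∈-family (criticalIndependent? H) (∪partner-critical G X-crit)) v∈))

  diademA⊆diadem : diademA G ⊆ diadem H
  diademA⊆diadem v∈ =
    let X , X-crit , v∈X = x∈⋃family⁻ (criticalIn? H A) v∈ in
    ⊆⋃ (∈-family (criticalIndependent? H) (∪partner-critical G X-crit))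
      (p⊆p∪q (partner G X) v∈X)

  diadem∩A⊆diademA : ∀ {v} → v ∈ diadem H → v ∈ A → v ∈ diademA G
  diadem∩A⊆diademA v∈ v∈A =
    let S , S-crit , v∈S = x∈⋃family⁻ (criticalIndependent? H) v∈ in
    ⊆⋃ (∈-family (criticalIn? H A) (critical∩A G S-crit)) (x∈p∩q⁺ (v∈S , v∈A))

  kerA≡partner-diademB : kerA G ≡ partner (swap G) (diademB G)
  kerA≡partner-diademB = ⊆-antisym
    -- The partner of the `B`-critical set `diademB G` is `A`-critical and so contains the kernel.
    (kerA⊆ (partner-critical (swap G) (diademIn-critical H B)))
    -- Conversely, the partner of any `A`-critical `X` lies in `diademB G`, so a vertex of `A`
    -- without neighbours in `diademB G` has none in that partner and must belong to `X`.
    λ {v} v∈ → x∈⋂family (criticalIn? H A) λ X-crit →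
      ∁N-partner⊆X G X-crit (partner⊆B (swap G) (diademB G) v∈)
        (partner∌N (swap G) (diademB G) v∈
          ∘ N-mono H (⊆⋃ (∈-family (criticalIn? H B) (partner-critical G X-crit))))

  ∣kerA∣+∣diademB∣≡α : ∣ kerA G ∣ + ∣ diademB G ∣ ≡ α H
  ∣kerA∣+∣diademB∣≡α = ℤ.+-injective (begin
    + (∣ kerA G ∣ + ∣ diademB G ∣)
      ≡⟨ cong (λ Z → + (∣ Z ∣ + ∣ diademB G ∣)) kerA≡partner-diademB ⟩
    + (∣ partner (swap G) (diademB G) ∣ + ∣ diademB G ∣)
      ≡⟨ cong +_ (ℕ.+-comm _ ∣ diademB G ∣) ⟩
    + (∣ diademB G ∣ + ∣ partner (swap G) (diademB G) ∣)
      ≡⟨ ∣X∣+∣partner∣ (swap G) (proj₁ (diademIn-critical H B)) ⟩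
    d H (diademB G) ℤ.+ + ∣ A ∣
      ≡⟨ cong (ℤ._+ + ∣ A ∣) (proj₂ (diademIn-critical H B)) ⟩
    δ₀ H B ℤ.+ + ∣ A ∣
      ≡⟨ α≡δ₀+∣B∣ (swap G) ⟨
    + α H ∎)
    where open ≡-Reasoning

-- Assembling the four assertions

module _ {n : ℕ} (G : BipartiteGraph n) where
  open BipartiteGraph G using () renaming (graph to H)

  kerA∪kerB≡ker : kerA G ∪ kerB G ≡ ker H
  kerA∪kerB≡ker = ⊆-antisym (∪-least (kerA⊆ker G) (kerA⊆ker (swap G)))
    λ {v} v∈ → x∈p∪q⁺
      (Sum.map (ker∩A⊆kerA G v∈) (ker∩A⊆kerA (swap G) v∈) (A-or-B G v))

  diademA∪diademB≡diadem : diademA G ∪ diademB G ≡ diadem H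
  diademA∪diademB≡diadem = ⊆-antisym (∪-least (diademA⊆diadem G) (diademA⊆diadem (swap G)))
    λ {v} v∈ → x∈p∪q⁺
      (Sum.map (diadem∩A⊆diademA G v∈) (diadem∩A⊆diademA (swap G) v∈) (A-or-B G v))

  ∣ker∣+∣diadem∣≡2α : ∣ ker H ∣ + ∣ diadem H ∣ ≡ 2 * α H
  ∣ker∣+∣diadem∣≡2α = begin
    ∣ ker H ∣ + ∣ diadem H ∣
      ≡⟨ cong₂ (λ p q → ∣ p ∣ + ∣ q ∣) kerA∪kerB≡ker diademA∪diademB≡diadem ⟨
    ∣ kerA G ∪ kerB G ∣ + ∣ diademA G ∪ diademB G ∣
      ≡⟨ cong₂ _+_
           (∣p∪q∣≡∣p∣+∣q∣ (kerA G) (kerB G)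
             λ v∈ → A∌B G (kerA⊆A G v∈) ∘ kerA⊆A (swap G))
           (∣p∪q∣≡∣p∣+∣q∣ (diademA G) (diademB G)
             λ v∈ → A∌B G (diademA⊆A G v∈) ∘ diademA⊆A (swap G)) ⟩
    (∣ kerA G ∣ + ∣ kerB G ∣) + (∣ diademA G ∣ + ∣ diademB G ∣)
      ≡⟨ regroup (∣ kerA G ∣) (∣ kerB G ∣) (∣ diademA G ∣) (∣ diademB G ∣) ⟩
    -- The trailing `0` matches the unfolding of `2 * α H`.
    (∣ kerA G ∣ + ∣ diademB G ∣) + ((∣ kerB G ∣ + ∣ diademA G ∣) + 0)
      ≡⟨ cong₂ (λ k l → k + (l + 0)) (∣kerA∣+∣diademB∣≡α G) (∣kerA∣+∣diademB∣≡α (swap G)) ⟩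
    2 * α H ∎
    where
    open ≡-Reasoning
    regroup : ∀ i j k l → (i + j) + (k + l) ≡ (i + l) + ((j + k) + 0)
    regroup = solve-∀-ℕ

theorem4p3 : ∀ {n : ℕ} (G : BipartiteGraph n) →
    (kerA G ∪ kerB G ≡ ker (graph G))
    × (∣ ker (graph G) ∣ + ∣ diadem (graph G) ∣ ≡ 2 * α (graph G))
    × ((∣ kerA G ∣ + ∣ diademB G ∣ ≡ ∣ kerB G ∣ + ∣ diademA G ∣)
    × (∣ kerB G ∣ + ∣ diademA G ∣ ≡ α (graph G)))
    × (diademA G ∪ diademB G ≡ diadem (graph G))
theorem4p3 G =
    kerA∪kerB≡ker G
  , ∣ker∣+∣diadem∣≡2α G
  , ( trans (∣kerA∣+∣diademB∣≡α G) (sym (∣kerA∣+∣diademB∣≡α (swap G)))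
    , ∣kerA∣+∣diademB∣≡α (swap G))
  , diademA∪diademB≡diadem G
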